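{- For $n \ge 0$ let $w(n,0)$ denote the number of compositions of $n$ with all parts in $\{1,2\}$ having exactly $0$ water cells. Then \[ \sum_{n \ge 0} w(n,0) q^n = \frac{1}{1-q} + \frac{q^2}{(1-q)^2(1-q^2)} = \frac{1-q+q^3}{1 - 2 q + 2 q^3 - q^4}. \] Moreover, for each $n \ge 0$ the following values are equal: (a) $w(n,0)$; (b) $\lfloor n^2/4 \rfloor + 1$; (c) $w(n-2,0) + n - 1$ (for $n \ge 2$); (d) $2w(n-1,0) - 2w(n-3,0) + w(n-4,0)$ (for $n \ge 4$).
   Context: A composition of $n \ge 0$ is a finite sequence $(c_1,\dots,c_t)$ of positive integers with $c_1+\cdots+c_t=n$; the empty composition is the unique composition of $0$. Let $C_{12}(n)$ be the set of compositions of $n$ all of whose parts lie in $\{1,2\}$. The number of water cells of a composition $(c_1,\dots,c_t)$ is $\sum_{i=1}^{t} \max\bigl(0, \min(\max_{j \le i} c_j, \max_{j \ge i} c_j) - c_i\bigr)$ (the number of unit squares that would hold water poured over its bargraph, in which column $i$ has height $c_i$). For $n,k \ge 0$, $W(n,k)$ is the set of compositions in $C_{12}(n)$ with exactly $k$ water cells and $w(n,k)=|W(n,k)|$. -}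

module Defs where

open import Data.Fin.Base using (Fin; toℕ)
open import Data.Integer.Base as ℤ using (ℤ; +_; 0ℤ; 1ℤ)
import Data.Integer.Properties as ℤ
open import Data.List.Base
  using (List; []; _∷_; _++_; [_]; map; filter; foldr; take; drop; length; lookup; tabulate)
open import Data.List.Membership.Propositional using (_∈_)
open import Data.List.Membership.Propositional.Properties
  using (∈-map⁺; ∈-map⁻; ∈-++⁺ˡ; ∈-++⁺ʳ; ∈-++⁻; ∈-filter⁺; ∈-filter⁻)
open import Data.List.Properties using (∷-injectiveʳ)
open import Data.List.Relation.Unary.All using (All; []; _∷_)
import Data.List.Relation.Unary.AllPairs as AllPairs
open import Data.List.Relation.Unary.Any using (here)
open import Data.List.Relation.Unary.Unique.Propositional using (Unique)
import Data.List.Relation.Unary.Unique.Propositional.Properties as Unique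
open import Data.Nat.Base using (ℕ; zero; suc; _∸_; _<_; _⊔_; _⊓_; s≤s; z≤n)
open import Data.Nat.ListAction using (sum)
open import Data.Nat.Properties using (_≟_; suc-injective)
open import Data.Product.Base using (_×_; _,_)
open import Data.Sum.Base using (_⊎_; inj₁; inj₂)
open import Function.Base using (_∘_)
open import Function.Bundles using (_⇔_; mk⇔; Equivalence)
open import Relation.Binary.PropositionalEquality hiding ([_])
open import Relation.Nullary.Decidable using (True)

------------------------------------------------------------------------
-- Compositions and water cells

IsComposition : ℕ → List ℕ → Set
IsComposition n c = All (0 <_) c × sum c ≡ n

PartsIn12 : List ℕ → Set
PartsIn12 = All (λ p → p ≡ 1 ⊎ p ≡ 2)

maximum : List ℕ → ℕ
maximum = foldr _⊔_ 0

-- Truncated subtraction plays the role of max(0, _ - _).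
waterAt : (c : List ℕ) → Fin (length c) → ℕ
waterAt c i =
  (maximum (take (suc (toℕ i)) c) ⊓ maximum (drop (toℕ i) c)) ∸ lookup c i

water : List ℕ → ℕ
water c = sum (tabulate (waterAt c))

-- An enumeration by first part; ∈C₁₂ and C₁₂-unique show that it lists
-- exactly the compositions of n with parts in {1,2}, once each.
C₁₂ : ℕ → List (List ℕ)
C₁₂ zero          = [ [] ]
C₁₂ (suc zero)    = [ 1 ∷ [] ]
C₁₂ (suc (suc n)) = map (1 ∷_) (C₁₂ (suc n)) ++ map (2 ∷_) (C₁₂ n)

W : ℕ → ℕ → List (List ℕ)
W n k = filter (λ c → water c ≟ k) (C₁₂ n)

w : ℕ → ℕ → ℕ
w n k = length (W n k)

C₁₂-sound : ∀ n {c} → c ∈ C₁₂ n → IsComposition n c × PartsIn12 c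
C₁₂-sound zero       (here refl) = ([] , refl) , []
C₁₂-sound (suc zero) (here refl) = (s≤s z≤n ∷ [] , refl) , inj₁ refl ∷ []
C₁₂-sound (suc (suc n)) p with ∈-++⁻ (map (1 ∷_) (C₁₂ (suc n))) p
... | inj₁ p₁ with _ , q , refl ← ∈-map⁻ (1 ∷_) p₁
             with (pos , eq) , parts ← C₁₂-sound (suc n) q
             = (s≤s z≤n ∷ pos , cong suc eq) , inj₁ refl ∷ parts
... | inj₂ p₂ with _ , q , refl ← ∈-map⁻ (2 ∷_) p₂
             with (pos , eq) , parts ← C₁₂-sound n q
             = (s≤s z≤n ∷ pos , cong (suc ∘ suc) eq) , inj₂ refl ∷ parts

C₁₂-complete : ∀ n {c} → sum c ≡ n → PartsIn12 c → c ∈ C₁₂ n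
C₁₂-complete zero          refl []                 = here refl
C₁₂-complete zero          ()   (inj₁ refl ∷ _)
C₁₂-complete zero          ()   (inj₂ refl ∷ _)
C₁₂-complete (suc zero)    eq   (inj₁ refl ∷ ps)
  with here refl ← C₁₂-complete zero (suc-injective eq) ps = here refl
C₁₂-complete (suc zero)    ()   (inj₂ refl ∷ _)
C₁₂-complete (suc (suc n)) eq   (inj₁ refl ∷ ps) =
  ∈-++⁺ˡ (∈-map⁺ (1 ∷_) (C₁₂-complete (suc n) (suc-injective eq) ps))
C₁₂-complete (suc (suc n)) eq   (inj₂ refl ∷ ps) =
  ∈-++⁺ʳ _ (∈-map⁺ (2 ∷_) (C₁₂-complete n (suc-injective (suc-injective eq)) ps))

∈C₁₂ : ∀ n c → c ∈ C₁₂ n ⇔ (IsComposition n c × PartsIn12 c)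
∈C₁₂ n c = mk⇔ (C₁₂-sound n) λ { ((_ , eq) , ps) → C₁₂-complete n eq ps }

C₁₂-unique : ∀ n → Unique (C₁₂ n)
C₁₂-unique zero          = [] AllPairs.∷ AllPairs.[]
C₁₂-unique (suc zero)    = [] AllPairs.∷ AllPairs.[]
C₁₂-unique (suc (suc n)) =
  Unique.++⁺ (Unique.map⁺ ∷-injectiveʳ (C₁₂-unique (suc n)))
             (Unique.map⁺ ∷-injectiveʳ (C₁₂-unique n))
             disjoint
  where
  disjoint : ∀ {c} → c ∈ map (1 ∷_) (C₁₂ (suc n)) × c ∈ map (2 ∷_) (C₁₂ n) → _
  disjoint (p , q) with _ , _ , refl ← ∈-map⁻ (1 ∷_) p | _ , _ , () ← ∈-map⁻ (2 ∷_) q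

∈W : ∀ n k c → c ∈ W n k ⇔ ((IsComposition n c × PartsIn12 c) × water c ≡ k)
∈W n k c = mk⇔
  (λ p → let q , e = ∈-filter⁻ P? p in Equivalence.to (∈C₁₂ n c) q , e)
  (λ { (q , e) → ∈-filter⁺ P? (Equivalence.from (∈C₁₂ n c) q) e })
  where P? = λ c → water c ≟ k

W-unique : ∀ n k → Unique (W n k)
W-unique n k = Unique.filter⁺ (λ c → water c ≟ k) (C₁₂-unique n)

------------------------------------------------------------------------
-- Formal power series over ℤ, as coefficient sequences; equality of
-- series is equality of all coefficients (_≗_).

Series : Set
Series = ℕ → ℤ

infixl 6 _+ˢ_ _-ˢ_
infixl 7 _*ˢ_ _/ˢ_
infixr 8 _^ˢ_

const : ℤ → Series
const a zero    = a
const a (suc _) = 0ℤ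

1ˢ : Series
1ˢ = const 1ℤ

q : Series
q (suc zero) = 1ℤ
q _          = 0ℤ

_+ˢ_ : Series → Series → Series
(f +ˢ g) n = f n ℤ.+ g n

_-ˢ_ : Series → Series → Series
(f -ˢ g) n = f n ℤ.- g n

-- ∑≤ n f = f 0 + f 1 + ⋯ + f n
∑≤ : ℕ → (ℕ → ℤ) → ℤ
∑≤ zero    f = f 0
∑≤ (suc n) f = f 0 ℤ.+ ∑≤ n (f ∘ suc)

_*ˢ_ : Series → Series → Series
(f *ˢ g) n = ∑≤ n (λ i → f i ℤ.* g (n ∸ i))

_^ˢ_ : Series → ℕ → Series
f ^ˢ zero  = 1ˢ
f ^ˢ suc n = f *ˢ (f ^ˢ n)

-- The reciprocal g of a series f with constant term 1 satisfies g₀ = 1 and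
-- gₙ₊₁ = - ∑_{i ≤ n} fᵢ₊₁ gₙ₋ᵢ.  To make the recursion structural,
-- recip-rev f n holds the coefficients up to gₙ in reverse: its i-th entry
-- is gₙ₋ᵢ.
recip-rev : Series → ℕ → ℕ → ℤ
recip-rev f zero    _       = 1ℤ
recip-rev f (suc n) zero    = ℤ.- ∑≤ n (λ i → f (suc i) ℤ.* recip-rev f n i)
recip-rev f (suc n) (suc i) = recip-rev f n i

recip : Series → Series
recip f n = recip-rev f n 0

-- The implicit side condition, that the constant term of the denominator is
-- 1, is solved automatically for closed denominators.
_/ˢ_ : Series → (g : Series) → {True (g 0 ℤ.≟ 1ℤ)} → Series
f /ˢ g = f *ˢ recip g

recip-rev≡recip : ∀ f n i → recip-rev f n i ≡ recip f (n ∸ i)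
recip-rev≡recip f zero    zero    = refl
recip-rev≡recip f zero    (suc i) = refl
recip-rev≡recip f (suc n) zero    = refl
recip-rev≡recip f (suc n) (suc i) = recip-rev≡recip f n i

∑≤-cong : ∀ n {f g : ℕ → ℤ} → f ≗ g → ∑≤ n f ≡ ∑≤ n g
∑≤-cong zero    e = e 0
∑≤-cong (suc n) e = cong₂ ℤ._+_ (e 0) (∑≤-cong n (e ∘ suc))

*ˢ-recip : ∀ f → f 0 ≡ 1ℤ → f *ˢ recip f ≗ 1ˢ
*ˢ-recip f f₀≡1 zero    = trans (ℤ.*-identityʳ (f 0)) f₀≡1
*ˢ-recip f f₀≡1 (suc n) = begin
  f 0 ℤ.* (ℤ.- S) ℤ.+ ∑≤ n (λ i → f (suc i) ℤ.* recip f (n ∸ i))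
    ≡⟨ cong₂ ℤ._+_ (cong (ℤ._* (ℤ.- S)) f₀≡1)
         (∑≤-cong n λ i → cong (f (suc i) ℤ.*_) (sym (recip-rev≡recip f n i))) ⟩
  1ℤ ℤ.* (ℤ.- S) ℤ.+ S
    ≡⟨ cong (ℤ._+ S) (ℤ.*-identityˡ (ℤ.- S)) ⟩
  ℤ.- S ℤ.+ S
    ≡⟨ ℤ.+-inverseˡ S ⟩
  0ℤ ∎
  where
  open ≡-Reasoning
  S = ∑≤ n (λ i → f (suc i) ℤ.* recip-rev f n i)

-- The generating function ∑ₙ w(n,k) qⁿ.
Wgf : ℕ → Series
Wgf k n = + w n k

{-# OPTIONS --safe #-}
module Submission where

-- Reading a composition from the left and remembering the maximum m of the
-- columns already passed, a dry composition (one without water) with m = 1 may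
-- continue with any part, while with m = 2 a part 1 forces all later parts to be 1.
-- Hence, with v(n) the number of c in C₁₂(n) such that 2 ∷ c is dry,
-- w(n+2,0) = w(n+1,0) + v(n) and v(n+2) = v(n) + 1, that is,
-- (1 - q) ∑ w(n,0) qⁿ = 1 + q² V with (1 - q²) V = 1/(1 - q).

open import Defs
open import Algebra.Bundles using (CommutativeRing)
import Algebra.Construct.Pointwise as Pointwise
import Algebra.Solver.Ring
import Algebra.Solver.Ring.AlmostCommutativeRing as ACR
open import Data.Bool.Base using (true; false)
open import Data.Fin.Base using (toℕ)
open import Data.Integer.Base as ℤ using (ℤ; +_; 0ℤ; 1ℤ)
import Data.Integer.Properties as ℤ
import Data.Integer.Solver as ℤ
open import Data.List.Base
  using (List; []; _∷_; map; filter; length; lookup; take; drop; tabulate)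
open import Data.List.Properties using (filter-++; filter-≐; filter-none; length-++; tabulate-cong)
open import Data.List.Relation.Unary.All using (universal)
import Data.Maybe.Base as Maybe
open import Data.Nat.Base using (ℕ; zero; suc; _+_; _*_; _∸_; _^_; _≤_; _⊔_; _⊓_; z≤n; s≤s)
open import Data.Nat.Divisibility using (divides-refl)
open import Data.Nat.DivMod using (_/_; +-distrib-/-∣ʳ; m*n/n≡m)
open import Data.Nat.ListAction using (sum)
import Data.Nat.Properties as ℕ
import Data.Nat.Solver as ℕ
open import Data.Product.Base using (_×_; _,_)
open import Function.Base using (_∘_; id)
open import Level using (0ℓ)
open import Relation.Binary.Consequences using (dec⇒weaklyDec)
open import Relation.Binary.PropositionalEquality
  using (_≡_; _≢_; _≗_; refl; sym; trans; cong; cong₂; module ≡-Reasoning)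
import Relation.Binary.Reasoning.Setoid as SetoidReasoning
open import Relation.Nullary.Decidable using (True; toWitness; does)
open import Relation.Unary using (Pred; Decidable)

-- Water computed from left to right

-- The water above a bargraph that stands to the right of columns of maximal height m.
waterRightOf : ℕ → List ℕ → ℕ
waterRightOf m []      = 0
waterRightOf m (x ∷ c) = ((m ⊔ x) ⊓ maximum (x ∷ c) ∸ x) + waterRightOf (m ⊔ x) c

-- The bound `m` is kept general because the induction passes from `m` to `m ⊔ x`; associativity of
-- `_⊔_` moves `x` from the prefix maximum into the bound.
waterRightOf-tabulate : ∀ m c →
  sum (tabulate λ i → (m ⊔ maximum (take (suc (toℕ i)) c)) ⊓ maximum (drop (toℕ i) c) ∸ lookup c i)
    ≡ waterRightOf m c
waterRightOf-tabulate m []      = refl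
waterRightOf-tabulate m (x ∷ c) = cong₂ _+_
  (cong (λ y → (m ⊔ y) ⊓ maximum (x ∷ c) ∸ x) (ℕ.⊔-identityʳ x))
  (trans (cong sum (tabulate-cong λ i →
            cong (λ y → y ⊓ maximum (drop (toℕ i) c) ∸ lookup c i)
                 (sym (ℕ.⊔-assoc m x (maximum (take (suc (toℕ i)) c))))))
         (waterRightOf-tabulate (m ⊔ x) c))

water≗waterRightOf-0 : water ≗ waterRightOf 0
water≗waterRightOf-0 = waterRightOf-tabulate 0

-- A column at least as high as all columns to its left is its own left maximum, so no water stands
-- on it.
waterRightOf-∷ : ∀ {m x} → m ≤ x → ∀ c → waterRightOf m (x ∷ c) ≡ waterRightOf x c
waterRightOf-∷ {m} {x} m≤x c rewrite ℕ.m≤n⇒m⊔n≡n m≤x =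
  cong (_+ waterRightOf x c) (ℕ.m≤n⇒m∸n≡0 (ℕ.m⊓n≤m x (maximum (x ∷ c))))

-- If `c` reaches height 2, the leading 1 already holds water and the hypothesis fails; otherwise
-- the extra 1 adds nothing.
waterRightOf-2-11⁺ : ∀ c → waterRightOf 2 (1 ∷ c) ≡ 0 → waterRightOf 2 (1 ∷ 1 ∷ c) ≡ 0
waterRightOf-2-11⁺ c with maximum c
... | zero        = id
... | suc zero    = id
... | suc (suc _) = λ ()

waterRightOf-2-11⁻ : ∀ c → waterRightOf 2 (1 ∷ 1 ∷ c) ≡ 0 → waterRightOf 2 (1 ∷ c) ≡ 0
waterRightOf-2-11⁻ c = ℕ.m+n≡0⇒n≡0 (2 ⊓ maximum (1 ∷ 1 ∷ c) ∸ 1)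

-- The 1 lies between two columns of height at least 2 and holds one cell; the cases on `maximum c`
-- only let the minimum compute.
waterRightOf-2-12 : ∀ c → waterRightOf 2 (1 ∷ 2 ∷ c) ≢ 0
waterRightOf-2-12 c with maximum c
... | zero        = λ ()
... | suc zero    = λ ()
... | suc (suc _) = λ ()

-- Counting dry compositions by their first part

length-filter-map : ∀ {A B : Set} {P : Pred B 0ℓ} (P? : Decidable P) (f : A → B) xs →
  length (filter P? (map f xs)) ≡ length (filter (P? ∘ f) xs)
length-filter-map P? f []       = refl
length-filter-map P? f (x ∷ xs) with does (P? (f x))
... | true  = cong suc (length-filter-map P? f xs)
... | false = length-filter-map P? f xs

-- The statistic `f` is a parameter so that a fixed first part can be absorbed into it, as in
-- `f ∘ (1 ∷_)`.
zeros : (List ℕ → ℕ) → ℕ → ℕ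
zeros f n = length (filter (λ c → f c ℕ.≟ 0) (C₁₂ n))

module _ {f g : List ℕ → ℕ} where

  zeros-⇔ : (∀ c → f c ≡ 0 → g c ≡ 0) → (∀ c → g c ≡ 0 → f c ≡ 0) → zeros f ≗ zeros g
  zeros-⇔ f⇒g g⇒f n = cong length
    (filter-≐ (λ c → f c ℕ.≟ 0) (λ c → g c ℕ.≟ 0) ((λ {c} → f⇒g c) , (λ {c} → g⇒f c)) (C₁₂ n))

  zeros-cong : f ≗ g → zeros f ≗ zeros g
  zeros-cong f≗g = zeros-⇔ (λ c → trans (sym (f≗g c))) (λ c → trans (f≗g c))

zeros-none : ∀ {f} → (∀ c → f c ≢ 0) → ∀ n → zeros f n ≡ 0
zeros-none {f} f≢0 n = cong length (filter-none (λ c → f c ℕ.≟ 0) (universal f≢0 (C₁₂ n)))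

zeros-+2 : ∀ f n → zeros f (2 + n) ≡ zeros (f ∘ (1 ∷_)) (1 + n) + zeros (f ∘ (2 ∷_)) n
zeros-+2 f n = begin
  length (filter f? (C₁₂ (2 + n)))
    ≡⟨ cong length (filter-++ f? (map (1 ∷_) (C₁₂ (1 + n))) _) ⟩
  _ ≡⟨ length-++ (filter f? (map (1 ∷_) (C₁₂ (1 + n)))) ⟩
  length (filter f? (map (1 ∷_) (C₁₂ (1 + n)))) + length (filter f? (map (2 ∷_) (C₁₂ n)))
    ≡⟨ cong₂ _+_ (length-filter-map f? (1 ∷_) (C₁₂ (1 + n))) (length-filter-map f? (2 ∷_) (C₁₂ n)) ⟩
  zeros (f ∘ (1 ∷_)) (1 + n) + zeros (f ∘ (2 ∷_)) n ∎
  where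
  open ≡-Reasoning
  f? : ∀ c → _
  f? c = f c ℕ.≟ 0

v : ℕ → ℕ
v = zeros (waterRightOf 2)

-- Only 1 + ⋯ + 1 stays dry after 2 + 1.
zeros-waterRightOf-2-1 : ∀ n → zeros (waterRightOf 2 ∘ (1 ∷_)) n ≡ 1
zeros-waterRightOf-2-1 zero          = refl
zeros-waterRightOf-2-1 (suc zero)    = refl
zeros-waterRightOf-2-1 (suc (suc n)) = trans (zeros-+2 (waterRightOf 2 ∘ (1 ∷_)) n) (cong₂ _+_
  (trans (zeros-⇔ waterRightOf-2-11⁻ waterRightOf-2-11⁺ (suc n)) (zeros-waterRightOf-2-1 (suc n)))
  (zeros-none waterRightOf-2-12 n))

v-+2 : ∀ n → v (2 + n) ≡ 1 + v n
v-+2 n = trans (zeros-+2 (waterRightOf 2) n)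
  (cong₂ _+_ (zeros-waterRightOf-2-1 (suc n)) (zeros-cong (waterRightOf-∷ {2} ℕ.≤-refl) n))

-- Each first part is at least `m`, hence dry, and becomes the new maximum. The right-hand side is
-- therefore independent of `m`, so heights 0 and 1 on the left give the same count.
zeros-waterRightOf≤1 : ∀ {m} → m ≤ 1 → ∀ n →
  zeros (waterRightOf m) (2 + n) ≡ zeros (waterRightOf 1) (1 + n) + v n
zeros-waterRightOf≤1 {m} m≤1 n = trans (zeros-+2 (waterRightOf m) n) (cong₂ _+_
  (zeros-cong (waterRightOf-∷ m≤1) (suc n))
  (zeros-cong (waterRightOf-∷ (ℕ.m≤n⇒m≤1+n m≤1)) n))

zeros-waterRightOf-0≗1 : zeros (waterRightOf 0) ≗ zeros (waterRightOf 1)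
zeros-waterRightOf-0≗1 zero          = refl
zeros-waterRightOf-0≗1 (suc zero)    = refl
zeros-waterRightOf-0≗1 (suc (suc n)) =
  trans (zeros-waterRightOf≤1 z≤n n) (sym (zeros-waterRightOf≤1 ℕ.≤-refl n))

w≗zeros : ∀ n → w n 0 ≡ zeros (waterRightOf 1) n
w≗zeros n = trans (zeros-cong water≗waterRightOf-0 n) (zeros-waterRightOf-0≗1 n)

w-+2 : ∀ n → w (2 + n) 0 ≡ w (1 + n) 0 + v n
w-+2 n = begin
  w (2 + n) 0                           ≡⟨ w≗zeros (2 + n) ⟩
  zeros (waterRightOf 1) (2 + n)        ≡⟨ zeros-waterRightOf≤1 ℕ.≤-refl n ⟩
  zeros (waterRightOf 1) (1 + n) + v n  ≡⟨ cong (_+ v n) (w≗zeros (1 + n)) ⟨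
  w (1 + n) 0 + v n                     ∎
  where open ≡-Reasoning

-- Two-step recurrence, closed form and linear recurrence

v-consecutive : ∀ n → v n + v (1 + n) ≡ 2 + n
v-consecutive zero    = refl
v-consecutive (suc n) = begin
  v (1 + n) + v (2 + n)      ≡⟨ cong (_+_ (v (1 + n))) (v-+2 n) ⟩
  v (1 + n) + suc (v n)      ≡⟨ ℕ.+-suc (v (1 + n)) (v n) ⟩
  suc (v (1 + n) + v n)      ≡⟨ cong suc (ℕ.+-comm (v (1 + n)) (v n)) ⟩
  suc (v n + v (1 + n))      ≡⟨ cong suc (v-consecutive n) ⟩
  3 + n                      ∎
  where open ≡-Reasoning

-- Two uses of `w-+2` add two consecutive values of `v`, whose sum grows by exactly one per step.
w-+2-w : ∀ n → w (2 + n) 0 ≡ w n 0 + (1 + n)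
w-+2-w zero    = refl
w-+2-w (suc n) = begin
  w (3 + n) 0                      ≡⟨ w-+2 (suc n) ⟩
  w (2 + n) 0 + v (1 + n)          ≡⟨ cong (_+ v (1 + n)) (w-+2 n) ⟩
  w (1 + n) 0 + v n + v (1 + n)    ≡⟨ ℕ.+-assoc (w (1 + n) 0) (v n) (v (1 + n)) ⟩
  w (1 + n) 0 + (v n + v (1 + n))  ≡⟨ cong (_+_ (w (1 + n) 0)) (v-consecutive n) ⟩
  w (1 + n) 0 + (2 + n)            ∎
  where open ≡-Reasoning

-- The square grows by the multiple `(1 + n) * 4` of 4, so the floor needs no parity cases.
[2+n]²/4 : ∀ n → (2 + n) ^ 2 / 4 ≡ n ^ 2 / 4 + (1 + n)
[2+n]²/4 n = begin
  (2 + n) ^ 2 / 4              ≡⟨ cong (_/ 4) (solve 1 (λ n →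
                                    (con 2 :+ n) :^ 2 := n :^ 2 :+ (con 1 :+ n) :* con 4) refl n) ⟩
  (n ^ 2 + (1 + n) * 4) / 4      ≡⟨ +-distrib-/-∣ʳ (n ^ 2) (divides-refl (1 + n)) ⟩
  n ^ 2 / 4 + (1 + n) * 4 / 4    ≡⟨ cong (_+_ (n ^ 2 / 4)) (m*n/n≡m (1 + n) 4) ⟩
  n ^ 2 / 4 + (1 + n)            ∎
  where
  open ≡-Reasoning
  open ℕ.+-*-Solver

w-closed : ∀ n → w n 0 ≡ n ^ 2 / 4 + 1
w-closed zero          = refl
w-closed (suc zero)    = refl
w-closed (suc (suc n)) = begin
  w (2 + n) 0                ≡⟨ w-+2-w n ⟩
  w n 0 + (1 + n)            ≡⟨ cong (_+ (1 + n)) (w-closed n) ⟩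
  n ^ 2 / 4 + 1 + (1 + n)    ≡⟨ solve 2 (λ x y → x :+ con 1 :+ y := x :+ y :+ con 1) refl (n ^ 2 / 4) (1 + n) ⟩
  n ^ 2 / 4 + (1 + n) + 1    ≡⟨ cong (_+ 1) ([2+n]²/4 n) ⟨
  (2 + n) ^ 2 / 4 + 1        ∎
  where
  open ≡-Reasoning
  open ℕ.+-*-Solver

w-two-back : ∀ n → 2 ≤ n → w n 0 ≡ w (n ∸ 2) 0 + n ∸ 1
w-two-back (suc (suc n)) (s≤s (s≤s _)) =
  -- The right-hand side parses as `(w n 0 + (2 + n)) ∸ 1`, so a successor must be brought to the
  -- front.
  trans (w-+2-w n) (cong (_∸ 1) (sym (ℕ.+-suc (w n 0) (suc n))))

w-linear-recurrence : ∀ n → 4 ≤ n →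
  + w n 0 ≡ + 2 ℤ.* + w (n ∸ 1) 0 ℤ.- + 2 ℤ.* + w (n ∸ 3) 0 ℤ.+ + w (n ∸ 4) 0
w-linear-recurrence (suc (suc (suc (suc n)))) (s≤s (s≤s (s≤s (s≤s _))))
  -- Only `w n 0`, `w (1 + n) 0` and `n` remain, and `w (1 + n) 0` cancels.
  rewrite w-+2-w (2 + n) | w-+2-w (1 + n) | w-+2-w n =
  solve 3 (λ a b n →
      a :+ (con 1ℤ :+ n) :+ (con (+ 3) :+ n)
        := con (+ 2) :* (b :+ (con (+ 2) :+ n)) :- con (+ 2) :* b :+ a)
    refl (+ w n 0) (+ w (1 + n) 0) (+ n)
  where open ℤ.+-*-Solver

-- The commutative ring of formal power series

infixr 8 _·_

_·_ : ℤ → Series → Series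
(a · f) n = a ℤ.* f n

-- (f *ˢ g) (suc n) is definitionally (f 0 · tail g +ˢ tail f *ˢ g) n, which drives
-- the inductions on n below.
tail : Series → Series
tail f = f ∘ suc

-ˢ_ : Series → Series
(-ˢ f) n = ℤ.- f n

0ˢ : Series
0ˢ _ = 0ℤ

*ˢ-cong : ∀ {f f′ g g′} → f ≗ f′ → g ≗ g′ → f *ˢ g ≗ f′ *ˢ g′
*ˢ-cong p r n = ∑≤-cong n λ i → cong₂ ℤ._*_ (p i) (r _)

*ˢ-zeroˡ : ∀ f → 0ˢ *ˢ f ≗ 0ˢ
*ˢ-zeroˡ f zero    = refl
*ˢ-zeroˡ f (suc n) = trans (ℤ.+-identityˡ _) (*ˢ-zeroˡ f n)

const-* : ∀ a f → const a *ˢ f ≗ a · f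
const-* a f zero    = refl
const-* a f (suc n) = trans (cong (ℤ._+_ (a ℤ.* f (suc n))) (*ˢ-zeroˡ f n)) (ℤ.+-identityʳ _)

*ˢ-identityˡ : ∀ f → 1ˢ *ˢ f ≗ f
*ˢ-identityˡ f n = trans (const-* 1ℤ f n) (ℤ.*-identityˡ (f n))

*ˢ-distribʳ : ∀ h f g → (f +ˢ g) *ˢ h ≗ f *ˢ h +ˢ g *ˢ h
*ˢ-distribʳ h f g zero    = ℤ.*-distribʳ-+ (h 0) (f 0) (g 0)
*ˢ-distribʳ h f g (suc n) = trans
  (cong (ℤ._+_ ((f 0 ℤ.+ g 0) ℤ.* h (suc n))) (*ˢ-distribʳ h (tail f) (tail g) n))
  (solve 5 (λ a b c x y → (a :+ b) :* c :+ (x :+ y) := (a :* c :+ x) :+ (b :* c :+ y))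
    refl (f 0) (g 0) (h (suc n)) ((tail f *ˢ h) n) ((tail g *ˢ h) n))
  where open ℤ.+-*-Solver

·-*ˢ : ∀ a f g → (a · f) *ˢ g ≗ a · (f *ˢ g)
·-*ˢ a f g zero    = ℤ.*-assoc a (f 0) (g 0)
·-*ˢ a f g (suc n) = trans
  (cong (ℤ._+_ (a ℤ.* f 0 ℤ.* g (suc n))) (·-*ˢ a (tail f) g n))
  (solve 4 (λ a b c x → a :* b :* c :+ a :* x := a :* (b :* c :+ x))
    refl a (f 0) (g (suc n)) ((tail f *ˢ g) n))
  where open ℤ.+-*-Solver

*ˢ-assoc : ∀ f g h → (f *ˢ g) *ˢ h ≗ f *ˢ (g *ˢ h)
*ˢ-assoc f g h zero    = ℤ.*-assoc (f 0) (g 0) (h 0)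
*ˢ-assoc f g h (suc n) = begin
  f 0 ℤ.* g 0 ℤ.* h (suc n) ℤ.+ ((f 0 · tail g +ˢ tail f *ˢ g) *ˢ h) n
    ≡⟨ cong (ℤ._+_ (f 0 ℤ.* g 0 ℤ.* h (suc n))) (trans
         (*ˢ-distribʳ h (f 0 · tail g) (tail f *ˢ g) n)
         (cong₂ ℤ._+_ (·-*ˢ (f 0) (tail g) h n) (*ˢ-assoc (tail f) g h n))) ⟩
  f 0 ℤ.* g 0 ℤ.* h (suc n) ℤ.+ (f 0 ℤ.* (tail g *ˢ h) n ℤ.+ (tail f *ˢ (g *ˢ h)) n)
    ≡⟨ solve 5 (λ a b c x y → a :* b :* c :+ (a :* x :+ y) := a :* (b :* c :+ x) :+ y)
         refl (f 0) (g 0) (h (suc n)) ((tail g *ˢ h) n) ((tail f *ˢ (g *ˢ h)) n) ⟩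
  f 0 ℤ.* (g 0 ℤ.* h (suc n) ℤ.+ (tail g *ˢ h) n) ℤ.+ (tail f *ˢ (g *ˢ h)) n ∎
  where
  open ≡-Reasoning
  open ℤ.+-*-Solver

-- Peels off the last term of the convolution where the definition peels off the first;
-- commutativity exchanges the two expansions.
*ˢ-suc : ∀ f g n → (f *ˢ g) (suc n) ≡ f (suc n) ℤ.* g 0 ℤ.+ (f *ˢ tail g) n
*ˢ-suc f g zero    = ℤ.+-comm (f 0 ℤ.* g 1) (f 1 ℤ.* g 0)
*ˢ-suc f g (suc n) = trans
  (cong (ℤ._+_ (f 0 ℤ.* g (suc (suc n)))) (*ˢ-suc (tail f) g n))
  (solve 3 (λ x y z → x :+ (y :+ z) := y :+ (x :+ z)) refl
    (f 0 ℤ.* g (suc (suc n))) (f (suc (suc n)) ℤ.* g 0) ((tail f *ˢ tail g) n))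
  where open ℤ.+-*-Solver

*ˢ-comm : ∀ f g → f *ˢ g ≗ g *ˢ f
*ˢ-comm f g zero    = ℤ.*-comm (f 0) (g 0)
*ˢ-comm f g (suc n) = trans (*ˢ-suc f g n)
  (cong₂ ℤ._+_ (ℤ.*-comm (f (suc n)) (g 0)) (*ˢ-comm f (tail g) n))

seriesRing : CommutativeRing 0ℓ 0ℓ
seriesRing = record
  { Carrier = Series
  ; _≈_ = _≗_
  ; _+_ = _+ˢ_
  ; _*_ = _*ˢ_
  ; -_  = -ˢ_
  ; 0#  = 0ˢ
  ; 1#  = 1ˢ
  ; isCommutativeRing = record
    { isRing = record
      { +-isAbelianGroup = Pointwise.isAbelianGroup ℕ ℤ.+-0-isAbelianGroup
      ; *-cong     = *ˢ-cong
      ; *-assoc    = *ˢ-assoc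
      ; *-identity = *ˢ-identityˡ , λ f n → trans (*ˢ-comm f 1ˢ n) (*ˢ-identityˡ f n)
      ; distrib    = (λ f g h n → trans (*ˢ-comm f (g +ˢ h) n) (trans (*ˢ-distribʳ f g h n)
                        (cong₂ ℤ._+_ (*ˢ-comm g f n) (*ˢ-comm h f n))))
                   , *ˢ-distribʳ
      }
    ; *-comm = *ˢ-comm
    }
  }

-- Constant series supply the ring solver with integer coefficients, whose equality is decidable.
const-homomorphism :
  CommutativeRing.rawRing ℤ.+-*-commutativeRing ACR.-Raw-AlmostCommutative⟶
  ACR.fromCommutativeRing seriesRing
const-homomorphism = record
  { ⟦_⟧    = const
  ; +-homo = λ { a b zero → refl ; a b (suc n) → refl }
  ; *-homo = λ { a b zero → refl
               ; a b (suc n) → sym (trans (const-* a (const b) (suc n)) (ℤ.*-zeroʳ a)) }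
  ; -‿homo = λ { a zero → refl ; a (suc n) → refl }
  ; 0-homo = λ { zero → refl ; (suc n) → refl }
  ; 1-homo = λ _ → refl
  }

open CommutativeRing seriesRing using (setoid; +-cong; +-congˡ; *-congˡ; *-congʳ)

module SeriesSolver = Algebra.Solver.Ring
  (CommutativeRing.rawRing ℤ.+-*-commutativeRing) (ACR.fromCommutativeRing seriesRing)
  const-homomorphism (λ a b → Maybe.map (λ a≡b n → cong (λ a → const a n) a≡b) (dec⇒weaklyDec ℤ._≟_ a b))

-- Shifts, quotients and fixed-point equations

q-*-suc : ∀ f n → (q *ˢ f) (suc n) ≡ f n
q-*-suc f n = trans (ℤ.+-identityˡ _) (trans (*ˢ-cong {g = f} tail-q (λ _ → refl) n) (*ˢ-identityˡ f n))
  where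
  tail-q : tail q ≗ 1ˢ
  tail-q zero    = refl
  tail-q (suc _) = refl

-- Multiplying by `recip g` cancels `g`, so an identity with a fraction can be checked after
-- clearing the denominator.
/ˢ-unique : ∀ {f} g {g₀ : True (g 0 ℤ.≟ 1ℤ)} h → g *ˢ h ≗ f → h ≗ (f /ˢ g) {g₀}
/ˢ-unique {f} g {g₀} h gh≗f = begin
  h                    ≈⟨ *ˢ-identityˡ h ⟨
  1ˢ *ˢ h              ≈⟨ *-congʳ {h} (*ˢ-recip g (toWitness g₀)) ⟨
  (g *ˢ recip g) *ˢ h  ≈⟨ solve 3 (λ x y z → (x :* y) :* z := (x :* z) :* y) (λ _ → refl) g (recip g) h ⟩
  (g *ˢ h) *ˢ recip g  ≈⟨ *-congʳ {recip g} gh≗f ⟩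
  f *ˢ recip g         ∎
  where
  open SetoidReasoning setoid
  open SeriesSolver

-- Turns a recurrence, read as an equation between coefficients, into an equation for the generating
-- function.
fixed-point : ∀ x f {g} → f ≗ g +ˢ x *ˢ f → (1ˢ -ˢ x) *ˢ f ≗ g
fixed-point x f {g} f≗g+xf n = begin
  ((1ˢ -ˢ x) *ˢ f) n
    ≡⟨ SeriesSolver.solve 2 (λ x f → (con 1ℤ :- x) :* f := f :- x :* f) (λ _ → refl) x f n ⟩
  f n ℤ.- (x *ˢ f) n
    ≡⟨ cong (ℤ._- (x *ˢ f) n) (f≗g+xf n) ⟩
  g n ℤ.+ (x *ˢ f) n ℤ.- (x *ˢ f) n
    ≡⟨ ℤ.+-assoc (g n) _ _ ⟩
  g n ℤ.+ ((x *ˢ f) n ℤ.- (x *ˢ f) n)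
    ≡⟨ cong (ℤ._+_ (g n)) (ℤ.+-inverseʳ ((x *ˢ f) n)) ⟩
  g n ℤ.+ 0ℤ
    ≡⟨ ℤ.+-identityʳ (g n) ⟩
  g n ∎
  where
  open ≡-Reasoning
  open SeriesSolver hiding (solve)

q²-*-suc² : ∀ f n → (q ^ˢ 2 *ˢ f) (2 + n) ≡ f n
q²-*-suc² f n = begin
  (q ^ˢ 2 *ˢ f) (2 + n)    ≡⟨ solve 2 (λ x f → x :^ 2 :* f := x :* (x :* f)) (λ _ → refl) q f (2 + n) ⟩
  (q *ˢ (q *ˢ f)) (2 + n)  ≡⟨ q-*-suc (q *ˢ f) (1 + n) ⟩
  (q *ˢ f) (1 + n)         ≡⟨ q-*-suc f n ⟩
  f n                      ∎
  where
  open ≡-Reasoning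
  open SeriesSolver

-- Generating functions of `v` and `w`

V ones : Series
V n    = + v n
ones _ = 1ℤ

ones-equation : (1ˢ -ˢ q) *ˢ ones ≗ 1ˢ
ones-equation = fixed-point q ones λ where
  zero    → refl
  (suc n) → sym (trans (ℤ.+-identityˡ _) (q-*-suc ones n))

V-equation : (1ˢ -ˢ q ^ˢ 2) *ˢ V ≗ ones
V-equation = fixed-point (q ^ˢ 2) V λ where
  -- Below degree 2 the shifted series vanishes, and `v 0` and `v 1` are both 1.
  zero          → refl
  (suc zero)    → refl
  (suc (suc n)) → trans (cong +_ (v-+2 n)) (cong (ℤ._+_ 1ℤ) (sym (q²-*-suc² V n)))

Wgf-equation : (1ˢ -ˢ q) *ˢ Wgf 0 ≗ 1ˢ +ˢ q ^ˢ 2 *ˢ V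
Wgf-equation = fixed-point q (Wgf 0) unfold
  where
  open ≡-Reasoning
  unfold : Wgf 0 ≗ (1ˢ +ˢ q ^ˢ 2 *ˢ V) +ˢ q *ˢ Wgf 0
  -- The summand `1ˢ` supplies `w 0 0`, the only value with no predecessor.
  unfold zero          = refl
  unfold (suc zero)    = refl
  unfold (suc (suc n)) = begin
    + w (2 + n) 0
      ≡⟨ cong +_ (trans (w-+2 n) (ℕ.+-comm (w (1 + n) 0) (v n))) ⟩
    V n ℤ.+ Wgf 0 (1 + n)
      ≡⟨ cong₂ ℤ._+_ (trans (ℤ.+-identityˡ _) (q²-*-suc² V n)) (q-*-suc (Wgf 0) (1 + n)) ⟨
    (1ˢ +ˢ q ^ˢ 2 *ˢ V) (2 + n) ℤ.+ (q *ˢ Wgf 0) (2 + n) ∎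

-- These expand `(1ˢ -ˢ q) *ˢ (1ˢ -ˢ q ^ˢ 2) +ˢ q ^ˢ 2` and `(1ˢ -ˢ q) ^ˢ 2 *ˢ (1ˢ -ˢ q ^ˢ 2)`, the
-- sum of the two fractions over their common denominator.
numerator denominator : Series
numerator   = 1ˢ -ˢ q +ˢ q ^ˢ 3
denominator = 1ˢ -ˢ const (+ 2) *ˢ q +ˢ const (+ 2) *ˢ q ^ˢ 3 -ˢ q ^ˢ 4

-- The three factors of the denominator are spent one at a time, on `Wgf 0`, then `V`, then `ones`.
denominator-*-Wgf : denominator *ˢ Wgf 0 ≗ numerator
denominator-*-Wgf = begin
  denominator *ˢ Wgf 0
    ≈⟨ solve 2 (λ q f →
         (con 1ℤ :- con (+ 2) :* q :+ con (+ 2) :* q :^ 3 :- q :^ 4) :* f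
           := (con 1ℤ :- q) :* (con 1ℤ :- q :^ 2) :* ((con 1ℤ :- q) :* f))
         (λ _ → refl) q (Wgf 0) ⟩
  (1ˢ -ˢ q) *ˢ (1ˢ -ˢ q ^ˢ 2) *ˢ ((1ˢ -ˢ q) *ˢ Wgf 0)
    ≈⟨ *-congˡ {(1ˢ -ˢ q) *ˢ (1ˢ -ˢ q ^ˢ 2)} Wgf-equation ⟩
  (1ˢ -ˢ q) *ˢ (1ˢ -ˢ q ^ˢ 2) *ˢ (1ˢ +ˢ q ^ˢ 2 *ˢ V)
    ≈⟨ solve 2 (λ q f →
         (con 1ℤ :- q) :* (con 1ℤ :- q :^ 2) :* (con 1ℤ :+ q :^ 2 :* f)
           := (con 1ℤ :- q) :* (con 1ℤ :- q :^ 2 :+ q :^ 2 :* ((con 1ℤ :- q :^ 2) :* f)))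
         (λ _ → refl) q V ⟩
  (1ˢ -ˢ q) *ˢ (1ˢ -ˢ q ^ˢ 2 +ˢ q ^ˢ 2 *ˢ ((1ˢ -ˢ q ^ˢ 2) *ˢ V))
    ≈⟨ *-congˡ {1ˢ -ˢ q} (+-congˡ {1ˢ -ˢ q ^ˢ 2} (*-congˡ {q ^ˢ 2} V-equation)) ⟩
  (1ˢ -ˢ q) *ˢ (1ˢ -ˢ q ^ˢ 2 +ˢ q ^ˢ 2 *ˢ ones)
    ≈⟨ solve 2 (λ q f →
         (con 1ℤ :- q) :* (con 1ℤ :- q :^ 2 :+ q :^ 2 :* f)
           := (con 1ℤ :- q) :* (con 1ℤ :- q :^ 2) :+ q :^ 2 :* ((con 1ℤ :- q) :* f))
         (λ _ → refl) q ones ⟩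
  (1ˢ -ˢ q) *ˢ (1ˢ -ˢ q ^ˢ 2) +ˢ q ^ˢ 2 *ˢ ((1ˢ -ˢ q) *ˢ ones)
    ≈⟨ +-congˡ {(1ˢ -ˢ q) *ˢ (1ˢ -ˢ q ^ˢ 2)} (*-congˡ {q ^ˢ 2} ones-equation) ⟩
  (1ˢ -ˢ q) *ˢ (1ˢ -ˢ q ^ˢ 2) +ˢ q ^ˢ 2 *ˢ 1ˢ
    ≈⟨ solve 1 (λ q →
         (con 1ℤ :- q) :* (con 1ℤ :- q :^ 2) :+ q :^ 2 :* con 1ℤ
           := con 1ℤ :- q :+ q :^ 3)
         (λ _ → refl) q ⟩
  numerator ∎
  where
  open SetoidReasoning setoid
  open SeriesSolver

partial-fractions : Series
partial-fractions = 1ˢ /ˢ (1ˢ -ˢ q) +ˢ q ^ˢ 2 /ˢ ((1ˢ -ˢ q) ^ˢ 2 *ˢ (1ˢ -ˢ q ^ˢ 2))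

-- Splitting the product lets each reciprocal cancel against its own denominator.
denominator-*-partial-fractions : denominator *ˢ partial-fractions ≗ numerator
denominator-*-partial-fractions = begin
  denominator *ˢ (1ˢ *ˢ x +ˢ q ^ˢ 2 *ˢ y)
    ≈⟨ solve 3 (λ q x y →
         (con 1ℤ :- con (+ 2) :* q :+ con (+ 2) :* q :^ 3 :- q :^ 4)
             :* (con 1ℤ :* x :+ q :^ 2 :* y)
           := (con 1ℤ :- q) :* (con 1ℤ :- q :^ 2) :* ((con 1ℤ :- q) :* x)
             :+ q :^ 2 :* ((con 1ℤ :- q) :^ 2 :* (con 1ℤ :- q :^ 2) :* y))
         (λ _ → refl) q x y ⟩
  (1ˢ -ˢ q) *ˢ (1ˢ -ˢ q ^ˢ 2) *ˢ ((1ˢ -ˢ q) *ˢ x)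
    +ˢ q ^ˢ 2 *ˢ ((1ˢ -ˢ q) ^ˢ 2 *ˢ (1ˢ -ˢ q ^ˢ 2) *ˢ y)
    ≈⟨ +-cong (*-congˡ {(1ˢ -ˢ q) *ˢ (1ˢ -ˢ q ^ˢ 2)} (*ˢ-recip (1ˢ -ˢ q) refl))
              (*-congˡ {q ^ˢ 2} (*ˢ-recip ((1ˢ -ˢ q) ^ˢ 2 *ˢ (1ˢ -ˢ q ^ˢ 2)) refl)) ⟩
  (1ˢ -ˢ q) *ˢ (1ˢ -ˢ q ^ˢ 2) *ˢ 1ˢ +ˢ q ^ˢ 2 *ˢ 1ˢ
    ≈⟨ solve 1 (λ q →
         (con 1ℤ :- q) :* (con 1ℤ :- q :^ 2) :* con 1ℤ :+ q :^ 2 :* con 1ℤ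
           := con 1ℤ :- q :+ q :^ 3)
         (λ _ → refl) q ⟩
  numerator ∎
  where
  open SetoidReasoning setoid
  open SeriesSolver
  x y : Series
  x = recip (1ˢ -ˢ q)
  y = recip ((1ˢ -ˢ q) ^ˢ 2 *ˢ (1ˢ -ˢ q ^ˢ 2))

theorem2p1 : (Wgf 0 ≗ 1ˢ /ˢ (1ˢ -ˢ q) +ˢ q ^ˢ 2 /ˢ ((1ˢ -ˢ q) ^ˢ 2 *ˢ (1ˢ -ˢ q ^ˢ 2)))
    × (1ˢ /ˢ (1ˢ -ˢ q) +ˢ q ^ˢ 2 /ˢ ((1ˢ -ˢ q) ^ˢ 2 *ˢ (1ˢ -ˢ q ^ˢ 2))
    ≗ (1ˢ -ˢ q +ˢ q ^ˢ 3) /ˢ (1ˢ -ˢ const (+ 2) *ˢ q +ˢ const (+ 2) *ˢ q ^ˢ 3 -ˢ q ^ˢ 4))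
    × ((n : ℕ) →
    (w n 0 ≡ n ^ 2 / 4 + 1)
    × (2 ≤ n → w n 0 ≡ w (n ∸ 2) 0 + n ∸ 1)
    × (4 ≤ n → + w n 0 ≡ + 2 ℤ.* + w (n ∸ 1) 0 ℤ.- + 2 ℤ.* + w (n ∸ 3) 0 ℤ.+ + w (n ∸ 4) 0))
theorem2p1 =
    -- Both series solve the same equation with `denominator`, so they meet at the single fraction.
    (λ n → trans (/ˢ-unique denominator (Wgf 0) denominator-*-Wgf n) (sym (fractions≗ n)))
  , fractions≗
  , λ n → w-closed n , w-two-back n , w-linear-recurrence n
  where
  fractions≗ : partial-fractions ≗ numerator /ˢ denominator
  fractions≗ = /ˢ-unique denominator partial-fractions denominator-*-partial-fractions
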